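{- For all integers $r\ge 3$ and $t\ge 1$, $\mathrm{cov}(r,r+t)\ge t+1$.
   Context: A complete $r$-uniform $r$-partite hypergraph $K$ has a vertex set $V=V(K)$ partitioned into nonempty classes $V_1\cup\dots\cup V_r$, and its edges are exactly the sets containing one vertex from each class. A $k$-coloring of a hypergraph is an assignment of a color from $[k]=\{1,\dots,k\}$ to each edge (not all $k$ colors need be used). A coloring is spanning if every vertex is incident to edges of every color used in the coloring. For an edge-colored hypergraph $H$, let $H_i$ be the subhypergraph on vertex set $V(H)$ consisting of the edges of color $i$. A hypergraph is connected if it has only one vertex or any two distinct vertices can be connected by a sequence of edges each intersecting the next; every hypergraph is uniquely partitioned into connected components. A monochromatic component of $H$ is (the vertex set of) a connected component of $H_i$ for some color $i$. Let $c(H)$ be the minimum integer $m$ such that $V(H)$ can be covered by $m$ monochromatic components of $H$. $\mathrm{cov}(r,k)$ is the maximum of $c(K)$ when $K$ ranges over all spanning $k$-colorings of complete $r$-uniform $r$-partite hypergraphs. -}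

module Defs where

open import Data.Nat.Base using (ℕ; _≤_; NonZero)
open import Data.Fin.Base using (Fin)
open import Data.Product.Base using (Σ-syntax; ∃-syntax; _×_; _,_; proj₁; proj₂)
open import Data.Sum.Base using (_⊎_)
open import Relation.Binary.Construct.Closure.ReflexiveTransitive using (Star)
open import Relation.Binary.PropositionalEquality.Core using (_≡_)

record Hypergraph : Set₁ where
  infix 4 _∈_
  field
    Vertex : Set
    Edge   : Set
    _∈_    : Vertex → Edge → Set

module _ (H : Hypergraph) where
  open Hypergraph H

  Intersect : Edge → Edge → Set
  Intersect e f = ∃[ x ] (x ∈ e × x ∈ f)

  -- Equal, or linked by a nonempty sequence e, …, f of edges, each
  -- intersecting the next.  The connected components of H are the classes of
  -- this equivalence relation.
  Linked : Vertex → Vertex → Set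
  Linked v w = v ≡ w ⊎ (∃[ e ] ∃[ f ] (v ∈ e × Star Intersect e f × w ∈ f))

module _ (H : Hypergraph) {k : ℕ} (colour : Hypergraph.Edge H → Fin k) where
  open Hypergraph H

  ColourClass : Fin k → Hypergraph
  ColourClass i = record
    { Vertex = Vertex
    ; Edge   = Σ[ e ∈ Edge ] colour e ≡ i
    ; _∈_    = λ v e → v ∈ proj₁ e
    }

  Spanning : Set
  Spanning = ∀ v i → (∃[ e ] colour e ≡ i) → (∃[ e ] (v ∈ e × colour e ≡ i))

  -- A monochromatic component is named by its colour and any one of its
  -- vertices, so a component may have several names.
  MonoComponent : Set
  MonoComponent = Fin k × Vertex

  InComponent : Vertex → MonoComponent → Set
  InComponent w (i , v) = Linked (ColourClass i) v w

  -- Repetitions in the family C are allowed; they do not affect the least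
  -- size of a cover.
  CoverableBy : ℕ → Set
  CoverableBy m =
    Σ[ C ∈ (Fin m → MonoComponent) ] (∀ w → ∃[ j ] InComponent w (C j))

IsMinimum : (ℕ → Set) → ℕ → Set
IsMinimum P m = P m × (∀ n → P n → m ≤ n)

IsMaximum : (ℕ → Set) → ℕ → Set
IsMaximum P m = P m × (∀ n → P n → n ≤ m)

-- IsC H colour m says c(H) = m.
IsC : (H : Hypergraph) {k : ℕ} (colour : Hypergraph.Edge H → Fin k) → ℕ → Set
IsC H colour = IsMinimum (CoverableBy H colour)

-- Class i has size i vertices.  An edge, being a set with exactly one vertex
-- in each class, is given as the function choosing that vertex.
CompletePartite : (r : ℕ) → (Fin r → ℕ) → Hypergraph
CompletePartite r size = record
  { Vertex = Σ[ i ∈ Fin r ] Fin (size i)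
  ; Edge   = ∀ i → Fin (size i)
  ; _∈_    = λ (i , x) e → e i ≡ x
  }

record ColouredCompletePartite (r k : ℕ) : Set where
  field
    size     : Fin r → ℕ
    nonempty : ∀ i → NonZero (size i)

  hypergraph : Hypergraph
  hypergraph = CompletePartite r size

  open Hypergraph hypergraph using (Edge)

  field
    colour : Edge → Fin k
    -- Pointwise equal choice functions are the same edge; without function
    -- extensionality this has to be required of the colouring.
    colour-cong : ∀ {e f : Edge} → (∀ i → e i ≡ f i) → colour e ≡ colour f

-- The numbers c(K), for K a spanning k-colouring of a complete r-uniform
-- r-partite hypergraph.
SpanningC : (r k : ℕ) → ℕ → Set
SpanningC r k m =
  Σ[ K ∈ ColouredCompletePartite r k ]
    let open ColouredCompletePartite K in
    Spanning hypergraph colour × IsC hypergraph colour m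

-- IsCov r k m says cov(r,k) = m.  The maximum is not computed, so cov is a
-- relation rather than a function.
IsCov : (r k : ℕ) → ℕ → Set
IsCov r k = IsMaximum (SpanningC r k)

{-# OPTIONS --safe #-}

-- A vertex carries a tuple of t colours at which it deviates (in every class
-- but the first, only the head of the tuple counts), one of t + 1 copy numbers
-- and a hint, which is a colour.  In colour i the vertices are labelled: those
-- not deviating at i share one label, the others are labelled by their copy.
-- An edge e deviates at no more than t + (r − 1) of the r + t colours, so some
-- colour is always free; e gets its hint (the majority among the hints of its
-- first three vertices) if its vertices have equal labels there, and otherwise
-- a free colour.  Hence labels are constant on monochromatic components.  The
-- colouring is spanning since a majority ignores one dissenter: join a vertex to
-- vertices with the same label in colour i that all have hint i.  Given t components, a vertex of the first
-- class that deviates at all their colours and whose copy number differs from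
-- those of the vertices naming them is uncovered.  Conversely, in each colour
-- the vertices not deviating there form one component, and no vertex deviates
-- at t + 1 colours.
module Submission where

open import Data.Nat.Base using (ℕ; zero; suc; _+_; _*_; _^_; _≤_; _<_; z≤n; s≤s; s≤s⁻¹)
open import Data.Nat.Properties using (≤-refl; ≤-reflexive; ≤-trans; +-comm; m≤n+m; _≤?_; ≰⇒>)
open import Data.Fin.Base using (Fin; zero; suc; inject≤; splitAt; _↑ˡ_; _↑ʳ_; punchIn;
  combine; quotient; remainder; remQuot; funToFin; finToFun)
open import Data.Fin.Properties using (_≟_; any?; all?; ¬∀⟶∃¬; pigeonhole; <⇒≢; nonZeroIndex;
  remQuot-combine; finToFun-funToFin; inject≤-injective; splitAt-↑ˡ; splitAt-↑ʳ; punchInᵢ≢i)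
open import Data.Maybe.Base using (Maybe; just; nothing)
open import Data.Maybe.Properties using (just-injective; ≡-dec)
open import Data.Product.Base using (Σ-syntax; ∃-syntax; _×_; _,_; proj₁; proj₂)
open import Data.Sum.Base using (inj₁; inj₂; [_,_]′)
open import Data.Vec.Base using (lookup; tabulate)
open import Data.Vec.Properties using (lookup∘tabulate; tabulate-cong)
open import Data.Vec.Functional using (updateAt)
open import Data.Vec.Functional.Properties using (updateAt-updates; updateAt-minimal)
open import Function.Base using (_∘_; id; const)
open import Relation.Binary.Construct.Closure.ReflexiveTransitive using (Star; ε; _◅_)
open import Relation.Binary.PropositionalEquality
open import Relation.Nullary using (¬_; Dec; yes; no; contradiction)
open import Defs

-- Pigeonhole, padding and majority vote.

private
  variable
    A : Set
    m n k : ℕ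

-- Otherwise choosing a preimage under `f` for each `g b` would give two indices the same one,
-- against injectivity of `g`.
missed : m < n → (f : Fin m → Fin k) (g : Fin n → Fin k) →
  (∀ {a b} → g a ≡ g b → a ≡ b) → ∃[ b ] (∀ a → f a ≢ g b)
missed {n = n} m<n f g g-inj with all? (λ b → any? (λ a → f a ≟ g b))
... | yes hit =
  let a , b , a<b , eq = pigeonhole m<n (proj₁ ∘ hit)
  in contradiction
       (g-inj (trans (sym (proj₂ (hit a))) (trans (cong f eq) (proj₂ (hit b)))))
       (<⇒≢ a<b)
... | no ¬hit =
  let b , ¬b = ¬∀⟶∃¬ n _ (λ b → any? (λ a → f a ≟ g b)) ¬hit
  in b , λ a eq → ¬b (a , eq)

extend : A → m ≤ n → (f : Fin m → A) → Σ[ g ∈ (Fin n → A) ] ∀ a → ∃[ b ] g b ≡ f a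
extend z z≤n f = const z , λ ()
extend {A = A} z (s≤s {n = n} m≤n) f = h , h-hits
  where
  g = extend z m≤n (f ∘ suc)
  h : Fin (suc n) → A
  h zero    = f zero
  h (suc b) = proj₁ g b
  h-hits : ∀ a → ∃[ b ] h b ≡ f a
  h-hits zero    = zero , refl
  h-hits (suc a) = let b , eq = proj₂ g a in suc b , eq

majority : Fin n → Fin n → Fin n → Fin n
majority a b c with a ≟ b
... | yes _ = a
-- Once `a` and `b` differ, `c` is the majority whenever there is one.
... | no  _ = c

majority-bc : (a b : Fin n) → majority a b b ≡ b
majority-bc a b with a ≟ b
... | yes eq = eq
... | no  _  = refl

majority-ac : (a b : Fin n) → majority a b a ≡ a
majority-ac a b with a ≟ b
... | yes _ = refl
... | no  _ = refl

majority-ab : (a c : Fin n) → majority a a c ≡ a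
majority-ab a c with a ≟ a
... | yes _   = refl
... | no  a≢a = contradiction refl a≢a

-- Vertices as triples of tuple, copy and hint.

record VertexCode (t n k : ℕ) : Set where
  field
    size   : ℕ
    encode : (Fin t → Fin k) → Fin n → Fin k → Fin size
    tuple  : Fin size → Fin t → Fin k
    copy   : Fin size → Fin n
    hint   : Fin size → Fin k
    tuple-encode : ∀ T c h a → tuple (encode T c h) a ≡ T a
    copy-encode  : ∀ T c h → copy (encode T c h) ≡ c
    hint-encode  : ∀ T c h → hint (encode T c h) ≡ h

vertexCode : ∀ t n k → VertexCode t n k
vertexCode t n k = record
  { size   = k ^ t * (n * k)
  ; encode = λ T c h → combine (funToFin T) (combine c h)
  ; tuple  = λ x → finToFun (quotient {k ^ t} (n * k) x)
  ; copy   = λ x → proj₁ (copyHint x)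
  ; hint   = λ x → proj₂ (copyHint x)
  ; tuple-encode = λ T c h a → trans
      (cong (λ q → finToFun (proj₁ q) a) (remQuot-combine (funToFin T) (combine c h)))
      (finToFun-funToFin T a)
  ; copy-encode  = λ T c h → cong proj₁ (copyHint-encode T c h)
  ; hint-encode  = λ T c h → cong proj₂ (copyHint-encode T c h)
  }
  where
  copyHint : Fin (k ^ t * (n * k)) → Fin n × Fin k
  copyHint x = remQuot {n} k (remainder {k ^ t} (n * k) x)
  copyHint-encode : ∀ T c h → copyHint (combine (funToFin T) (combine c h)) ≡ (c , h)
  copyHint-encode T c h = trans
    (cong (remQuot {n} k ∘ proj₂) (remQuot-combine (funToFin T) (combine c h)))
    (remQuot-combine c h)

-- The code of the vertices is a parameter, and choice below is abstract, because
-- conversion checking is infeasible once either of them unfolds.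
module Construction (r′ t′ : ℕ)
  (code : VertexCode (suc t′) (suc t′ + 1) (3 + r′ + suc t′)) where

  open VertexCode code

  r = 3 + r′
  t = suc t′

  Class  = Fin r
  Colour = Fin (r + t)
  Copy   = Fin (t + 1)
  Code   = Fin size

  H : Hypergraph
  H = CompletePartite r (const size)

  open Hypergraph H using (Vertex; Edge; _∈_)

  -- Deviations and labels.

  deviation : Class → Code → Fin t → Colour
  deviation zero    x a = tuple x a
  deviation (suc j) x a = tuple x zero

  Deviates : Colour → Class → Code → Set
  Deviates i j x = ∃[ a ] deviation j x a ≡ i

  deviates? : ∀ i j x → Dec (Deviates i j x)
  deviates? i j x = any? (λ a → deviation j x a ≟ i)

  deviation-const : ∀ j d c h a → deviation j (encode (const d) c h) a ≡ d
  deviation-const zero    d c h a = tuple-encode (const d) c h a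
  deviation-const (suc j) d c h a = tuple-encode (const d) c h zero

  label : Colour → Class → Code → Maybe Copy
  label i j x with deviates? i j x
  ... | yes _ = just (copy x)
  ... | no  _ = nothing

  label-deviates : ∀ {i} j x → Deviates i j x → label i j x ≡ just (copy x)
  label-deviates {i} j x dev with deviates? i j x
  ... | yes _    = refl
  ... | no  ¬dev = contradiction dev ¬dev

  label-free : ∀ {i} j x → ¬ Deviates i j x → label i j x ≡ nothing
  label-free {i} j x ¬dev with deviates? i j x
  ... | yes dev = contradiction dev ¬dev
  ... | no  _   = refl

  label-just⇒copy : ∀ {i j x c} → label i j x ≡ just c → copy x ≡ c
  label-just⇒copy {i} {j} {x} eq with deviates? i j x
  ... | yes _ = just-injective eq

  label-const : ∀ {d} j c h → label d j (encode (const d) c h) ≡ just c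
  label-const {d} j c h = trans
    (label-deviates j _ (zero , deviation-const j d c h zero))
    (cong just (copy-encode (const d) c h))

  label-const-≢ : ∀ {i d} j c h → d ≢ i → label i j (encode (const d) c h) ≡ nothing
  label-const-≢ {i} {d} j c h d≢i =
    label-free j _ λ (a , eq) → d≢i (trans (sym (deviation-const j d c h a)) eq)

  -- Colouring the edges.

  Agree : Colour → Edge → Set
  Agree i e = ∀ j → label i j (e j) ≡ label i zero (e zero)

  agree? : ∀ i e → Dec (Agree i e)
  agree? i e = all? (λ j → ≡-dec _≟_ (label i j (e j)) (label i zero (e zero)))

  hintOf : Edge → Colour
  hintOf e = majority (hint (e zero)) (hint (e (suc zero))) (hint (e (suc (suc zero))))

  free : (e : Edge) → ∃[ i ] ∀ j → ¬ Deviates i j (e j)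
  free e =
    -- `f` lists t + (r - 1) colours, one fewer than there are.
    let i , f≢i = missed (s≤s (≤-reflexive (+-comm t (2 + r′)))) f id id
    in i , notDeviating i f≢i
    where
    pick : _ → Colour
    pick = [ deviation zero (e zero) , (λ j → deviation (suc j) (e (suc j)) zero) ]′
    f : Fin (t + (2 + r′)) → Colour
    f = pick ∘ splitAt t
    notDeviating : ∀ i → (∀ a → f a ≢ i) → ∀ j → ¬ Deviates i j (e j)
    notDeviating i f≢i zero    (a , eq) =
      f≢i (a ↑ˡ (2 + r′)) (trans (cong pick (splitAt-↑ˡ t a (2 + r′))) eq)
    notDeviating i f≢i (suc j) (a , eq) =
      f≢i (t ↑ʳ j) (trans (cong pick (splitAt-↑ʳ t (2 + r′) j)) eq)

  -- Agreement will make labels constant on components; the clause on the hint will produce edges of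
  -- a prescribed colour.
  Choice : Edge → Set
  Choice e = ∃[ i ] (Agree i e × (Agree (hintOf e) e → i ≡ hintOf e))

  choose : ∀ e → Dec (Agree (hintOf e) e) → Choice e
  choose e (yes agree) = hintOf e , agree , λ _ → refl
  choose e (no ¬agree) =
    let i , ¬dev = free e
    in i , (λ j → trans (label-free j (e j) (¬dev j)) (sym (label-free zero (e zero) (¬dev zero))))
         , λ agree → contradiction agree ¬agree

  abstract
    choice : ∀ e → Choice e
    choice e = choose e (agree? (hintOf e) e)

  -- Passing through a vector makes the colour depend only on the values of e.
  normalise : Edge → Edge
  normalise e = lookup (tabulate e)

  normalise-≗ : ∀ e j → normalise e j ≡ e j
  normalise-≗ = lookup∘tabulate

  colour : Edge → Colour
  colour e = proj₁ (choice (normalise e))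

  colour-cong : ∀ {e f : Edge} → (∀ j → e j ≡ f j) → colour e ≡ colour f
  colour-cong eq = cong (proj₁ ∘ choice ∘ lookup) (tabulate-cong eq)

  colouring : ColouredCompletePartite r (r + t)
  colouring = record
    { size        = const size
    ; nonempty    = λ _ → nonZeroIndex (encode (const zero) zero zero)
    ; colour      = colour
    ; colour-cong = colour-cong
    }

  agree-resp : ∀ {i e f} → (∀ j → e j ≡ f j) → Agree i e → Agree i f
  agree-resp {i} eq agree j = subst₂ (λ x y → label i j x ≡ label i zero y)
    (eq j) (eq zero) (agree j)

  colour-agree : ∀ e → Agree (colour e) e
  colour-agree e = agree-resp (normalise-≗ e) (proj₁ (proj₂ (choice (normalise e))))

  hintOf-cong : ∀ {e f : Edge} → (∀ j → e j ≡ f j) → hintOf e ≡ hintOf f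
  hintOf-cong {e} {f} eq rewrite eq zero | eq (suc zero) | eq (suc (suc zero)) = refl

  colour-hint : ∀ e {i} → hintOf e ≡ i → Agree i e → colour e ≡ i
  colour-hint e {i} h agree = trans
    (proj₂ (proj₂ (choice (normalise e)))
      (subst (λ i → Agree i (normalise e)) (sym h′)
        (agree-resp (λ j → sym (normalise-≗ e j)) agree)))
    h′
    where
    h′ : hintOf (normalise e) ≡ i
    h′ = trans (hintOf-cong (normalise-≗ e)) h

  -- The vertices of an edge of colour `i` share their label at `i`, and consecutive edges of a path
  -- share a vertex.
  label-component : ∀ {i j x j′ y} →
    Linked (ColourClass H colour i) (j , x) (j′ , y) → label i j x ≡ label i j′ y
  label-component (inj₁ refl) = refl
  label-component {i} (inj₂ (e , f , x∈e , path , y∈f)) =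
    trans (onEdge e x∈e) (trans (along path) (sym (onEdge f y∈f)))
    where
    K = ColourClass H colour i
    common : Hypergraph.Edge K → Maybe Copy
    common (e , _) = label i zero (e zero)
    onEdge : ∀ {j x} (e : Hypergraph.Edge K) → proj₁ e j ≡ x → label i j x ≡ common e
    onEdge {j} (e , refl) refl = colour-agree e j
    along : ∀ {e f} → Star (Intersect K) e f → common e ≡ common f
    along ε = refl
    along {e} (_◅_ {j = g} (_ , z∈e , z∈g) path) =
      trans (sym (onEdge e z∈e)) (trans (onEdge g z∈g) (along path))

  -- Edges through a given vertex, and spanning.

  edge : Vertex → Code → Edge
  edge (j , x) u = updateAt (const u) j (const x)

  edge-here : ∀ j x u → edge (j , x) u j ≡ x
  edge-here j x u = updateAt-updates j (const u)

  edge-there : ∀ {j j′} x u → j′ ≢ j → edge (j , x) u j′ ≡ u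
  edge-there {j} {j′} x u j′≢j = updateAt-minimal j′ j (const u) j′≢j

  -- The three voters lie in distinct classes, which is where r ≥ 3 enters, so `x` replaces at most
  -- one of them.
  hintOf-edge : ∀ j x u → hintOf (edge (j , x) u) ≡ hint u
  hintOf-edge zero                x u = majority-bc (hint x) (hint u)
  hintOf-edge (suc zero)          x u = majority-ac (hint u) (hint x)
  hintOf-edge (suc (suc zero))    x u = majority-ab (hint u) (hint x)
  hintOf-edge (suc (suc (suc j))) x u = majority-ab (hint u) (hint u)

  colour-edge : ∀ {i} j x u → hint u ≡ i → (∀ j′ → label i j′ u ≡ label i j x) →
    colour (edge (j , x) u) ≡ i
  colour-edge {i} j x u h same =
    colour-hint (edge (j , x) u) (trans (hintOf-edge j x u) h)
      (λ j′ → trans (toX j′) (sym (toX zero)))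
    where
    toX : ∀ j′ → label i j′ (edge (j , x) u j′) ≡ label i j x
    toX j′ with j′ ≟ j
    ... | yes refl = cong (label i j) (edge-here j x u)
    ... | no  j′≢j = trans (cong (label i j′) (edge-there x u j′≢j)) (same j′)

  -- With a constant tuple, `u` deviates at the same single colour in every class, so its label does
  -- not depend on the class.
  companion : ∀ i j x → ∃[ u ] (hint u ≡ i × (∀ j′ → label i j′ u ≡ label i j x))
  companion i j x with deviates? i j x
  ... | yes _    = encode (const i) (copy x) i , hint-encode (const i) (copy x) i
                 , λ j′ → label-const j′ (copy x) i
  ... | no  ¬dev = encode (const d) zero i , hint-encode (const d) zero i
                 , λ j′ → label-const-≢ j′ zero i λ eq → ¬dev (zero , eq)
    -- Any colour other than `i` would do; `x` supplies one, as it does not deviate at `i`.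
    where d = deviation j x zero

  spanning : Spanning H colour
  spanning (j , x) i _ =
    let u , h , same = companion i j x
    in edge (j , x) u , edge-here j x u , colour-edge j x u h same

  -- The covering number of the construction.

  base : Colour → Code
  base i = encode (const (punchIn i zero)) zero i

  label-base : ∀ i j → label i j (base i) ≡ nothing
  label-base i j = label-const-≢ j zero i (punchInᵢ≢i i zero)

  free-linked : ∀ {i} j x → ¬ Deviates i j x →
    Linked (ColourClass H colour i) (zero , base i) (j , x)
  free-linked {i} j x ¬dev = inj₂
    ( (edge (zero , u) u , coloured zero u (label-base i zero))
    , (edge (j , x) u , coloured j x (label-free j x ¬dev))
    , refl
    , meet j ◅ ε
    , edge-here j x u )
    where
    u = base i
    coloured : ∀ j x → label i j x ≡ nothing → colour (edge (j , x) u) ≡ i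
    coloured j x eq = colour-edge j x u (hint-encode _ zero i)
      (λ j′ → trans (label-base i j′) (sym eq))
    meet : ∀ j → ∃[ z ] (z ∈ edge (zero , u) u × z ∈ edge (j , x) u)
    -- If `x` lies in the first class it displaces `u` there, so the two edges meet in the second
    -- class.
    meet zero    = (suc zero , u) , refl , refl
    meet (suc j) = (zero , u) , refl , refl

  coverable : CoverableBy H colour (t + 1)
  coverable = (λ b → ι b , (zero , base (ι b))) , λ (j , x) →
    let b , dev≢b = missed (≤-reflexive (+-comm 1 t)) (deviation j x) ι
                      (inject≤-injective ι-≤ ι-≤ _ _)
    in b , free-linked j x (λ (a , eq) → dev≢b a eq)
    where
    ι-≤ : t + 1 ≤ r + t
    ι-≤ = ≤-trans (≤-reflexive (+-comm t 1)) (s≤s (m≤n+m t (2 + r′)))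
    ι : Fin (t + 1) → Colour
    ι b = inject≤ b ι-≤

  not-coverable : m ≤ t → ¬ CoverableBy H colour m
  not-coverable {m} m≤t (C , covers) =
    let b , x∈C = covers (zero , x)
        a , Ta≡ = T-hits b
        x-label = label-deviates zero x (a , trans (tuple-encode T c zero a) Ta≡)
    -- The label `just c` of `x` passes to the vertex naming its component, whose copy would then be
    -- `c`.
    in unused b (trans (label-just⇒copy (trans (label-component x∈C) x-label))
                       (copy-encode T c zero))
    where
    -- At most t naming vertices cannot use up t + 1 copies.
    fresh = missed (≤-trans (s≤s m≤t) (≤-reflexive (+-comm 1 t)))
                   (λ b → copy (proj₂ (proj₂ (C b)))) id id
    c      = proj₁ fresh
    unused = proj₂ fresh
    -- Padding with colour `zero` is harmless: `x` may deviate at further colours.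
    tup    = extend zero m≤t (proj₁ ∘ C)
    T      = proj₁ tup
    T-hits = proj₂ tup
    x      = encode T c zero

  minimum : IsC H colour (t + 1)
  minimum = coverable , least
    where
    least : ∀ m → CoverableBy H colour m → t + 1 ≤ m
    least m cov with t + 1 ≤? m
    ... | yes le = le
    ... | no ¬le = contradiction cov
      (not-coverable (s≤s⁻¹ (≤-trans (≰⇒> ¬le) (≤-reflexive (+-comm t 1)))))

  spanningC : SpanningC r (r + t) (t + 1)
  spanningC = colouring , spanning , minimum

theorem2p1 : (r t : ℕ) → 3 ≤ r → 1 ≤ t →
    (∃[ n ] (SpanningC r (r + t) n × t + 1 ≤ n)) ×
    (∀ m → IsCov r (r + t) m → t + 1 ≤ m)
theorem2p1 (suc (suc (suc r′))) (suc t′) (s≤s (s≤s (s≤s z≤n))) (s≤s z≤n) =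
  (_ , spanningC , ≤-refl) , λ m isCov → proj₂ isCov _ spanningC
  where open Construction r′ t′ (vertexCode _ _ _)
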